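{- Let $\mathcal{H}$ be a mixed graph with nodes $\mathcal{V}$ and edges $\mathcal{E}$ of the types $\{\rightarrow,\leftarrow,\leftrightarrow,-\}$. Then the following are equivalent: (i) there exist a set $\mathcal{S}$ (disjoint from $\mathcal{V}$) and a directed mixed graph (DMG) $\mathcal{G}$ with node set $\mathcal{V}^+=\mathcal{V}\cup\mathcal{S}$ such that $\mathcal{H}$ represents $\mathcal{G}$ given $\mathcal{S}$; (ii) $\mathcal{H}$ is a $\sigma$-MAG.
   Context: **Mixed graphs.** A mixed graph $\mathcal{H}=(\mathcal{V},\mathcal{E})$ has nodes $\mathcal{V}$ and edges between nodes of the types $\rightarrow,\leftarrow,\leftrightarrow,-$ ($a\rightarrow b$ is the same as $b\leftarrow a$; $\leftrightarrow$ and $-$ are symmetric). Each edge has a mark (tail or arrowhead) at each end; $*$ stands for either mark: $a\mathrel{*\!\!\rightarrow} b$ (equivalently $b\mathrel{\leftarrow\!\!*}a$) means $a\rightarrow b$ or $a\leftrightarrow b$ (the edge is into $b$); $a\mathrel{ -\!\!*}b$ means $a\rightarrow b$ or $a-b$ (the edge is out of $a$). Two nodes are adjacent if there is an edge between them. A walk between $v_0$ and $v_n$ ($n\ge 0$) is an alternating sequence $v_0,e_1,v_1,\dots,e_n,v_n$ with $e_i$ an edge between $v_{i-1}$ and $v_i$; it is a path if no node occurs more than once. It is a directed walk (path) from $v_0$ to $v_n$ if $e_i$ is $v_{i-1}\rightarrow v_i$ for all $i$, and an anterior walk (path) from $v_0$ to $v_n$ if $e_i$ is $v_{i-1}\mathrel{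 -\!\!*}v_i$ for all $i$. $\mathrm{Anc}_{\mathcal H}(b)$ is the set of nodes from which there is a directed walk to $b$ (so $b\in\mathrm{Anc}_{\mathcal H}(b)$), and $\mathrm{Anc}_{\mathcal H}(A)=\bigcup_{v\in A}\mathrm{Anc}_{\mathcal H}(v)$. A non-endpoint $v_k$ of a walk is a collider on it if both adjacent edges on the walk have an arrowhead at $v_k$; all other nodes on the walk, including endpoints, are non-colliders. An inducing path is a path between $v_0$ and $v_n$ on which every non-endpoint node is a collider and belongs to $\mathrm{Anc}_{\mathcal H}(\{v_0,v_n\})$. **$\sigma$-MAG.** A mixed graph $\mathcal H$ is a $\sigma$-MAG if: (1) between any two distinct nodes there is at most one edge, and no node is adjacent to itself; (2) (ancestral) if $\mathcal H$ contains an anterior path from $a$ to $b$, then it contains no edge $a\mathrel{\leftarrow\!\!*}b$; (3a) (maximal) there is no inducing path between any two distinct non-adjacent nodes; (3b) ($\sigma$-complete) if $\mathcal H$ contains $a\mathrel{*\!\!\rightarrow}b$ and $b-c$, then $a$ and $c$ are adjacent; and if moreover $\mathcal H$ contains $b-d$ with $d\ne c$, then $c$ and $d$ are adjacent. **DMGs.** A DMG $\mathcal G$ has a node set, directed edges $u\rightarrow v$ and bidirected (symmetric) edges $u\leftrightarrow v$ between distinct nodes; at most one edge of each of the types $u\rightarrow v$, $v\rightarrow u$, $u\leftrightarrow v$ between each pair (several types may coexist), no self-loops. Walks, paths, $\mathrm{Anc}_{\mathcal G}$, colliders and non-colliders are defined as for mixed graphs. $\mathrm{Sc}_{\mathcal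 G}(v)$ is the strongly connected component of $v$: all $w$ with $w\in\mathrm{Anc}_{\mathcal G}(v)$ and $v\in\mathrm{Anc}_{\mathcal G}(w)$. A non-collider $v_k$ on a walk is unblockable if it is not an endpoint and every directed edge on the walk going out of $v_k$ to a neighbouring node $v_{k\pm1}$ on the walk satisfies $v_{k\pm1}\in\mathrm{Sc}_{\mathcal G}(v_k)$. For distinct $v_i,v_j\in\mathcal V$, a path (walk) in $\mathcal G$ between $v_i$ and $v_j$ is $\sigma$-inducing given $\mathcal S$ if each collider on it is in $\mathrm{Anc}_{\mathcal G}(\{v_i,v_j\}\cup\mathcal S)$ and each non-endpoint non-collider on it is unblockable. **Representation.** Let $\mathcal G$ be a DMG with nodes $\mathcal V\cup\mathcal S$. The mixed graph $\mathcal H$ with nodes $\mathcal V$ represents $\mathcal G$ given $\mathcal S$ if: (1) in $\mathcal H$ there is at most one edge between any two distinct nodes and no edge from a node to itself; (2) distinct $a,b\in\mathcal V$ are adjacent in $\mathcal H$ if and only if there is a $\sigma$-inducing path between $a$ and $b$ given $\mathcal S$ in $\mathcal G$; (3) if $a\mathrel{\leftarrow\!\!*}b$ in $\mathcal H$ then $a\notin\mathrm{Anc}_{\mathcal G}(\{b\}\cup\mathcal S)$; (4) if $a\mathrel{ -\!\!*}b$ in $\mathcal H$ then $a\in\mathrm{Anc}_{\mathcal G}(\{b\}\cup\mathcal S)$. -}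

module Defs where

open import Level using (Level; suc)
open import Data.List.Base using (List; []; _∷_)
open import Data.List.Relation.Unary.Unique.Propositional using (Unique)
open import Data.Product.Base using (Σ-syntax; ∃-syntax; _×_)
open import Data.Sum.Base using (_⊎_; inj₁; inj₂)
open import Data.Unit.Polymorphic.Base using (⊤)
open import Function.Bundles using (_⇔_)
open import Relation.Binary.Core using (Rel)
open import Relation.Binary.Definitions using (Symmetric)
open import Relation.Binary.PropositionalEquality.Core using (_≡_; _≢_)
open import Relation.Nullary.Negation.Core using (¬_)
open import Relation.Unary using (Pred; _∈_; _∉_; _∪_; ｛_｝)

private
  variable
    ℓ : Level

-- Only inhabitation of the three relations is meaningful: an edge is
-- determined by its end nodes and its type.  Edges of several types between
-- the same nodes, and self-loops, are allowed at this level.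
record MixedGraph (V : Set ℓ) : Set (suc ℓ) where
  infix 4 _⟶_ _⟷_ _──_
  field
    _⟶_    : Rel V ℓ
    _⟷_    : Rel V ℓ
    _──_   : Rel V ℓ
    ⟷-sym  : Symmetric _⟷_
    ──-sym : Symmetric _──_

data Mark : Set where
  tail head : Mark

module _ {V : Set ℓ} (H : MixedGraph V) where
  open MixedGraph H

  -- Edge a m m′ b: an edge between a and b with mark m at a and m′ at b.
  -- Leaving one mark arbitrary renders the "∗" of the usual notation:
  -- Edge a m head b is a ∗→ b, and Edge a tail m b is a −∗ b.
  data Edge (a : V) : Mark → Mark → V → Set ℓ where
    right  : ∀ {b} → a ⟶ b  → Edge a tail head b
    left   : ∀ {b} → b ⟶ a  → Edge a head tail b
    bidir  : ∀ {b} → a ⟷ b  → Edge a head head b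
    undir  : ∀ {b} → a ── b → Edge a tail tail b

  Adjacent : Rel V ℓ
  Adjacent a b = ∃[ m ] ∃[ m′ ] Edge a m m′ b

  infixr 5 _∷_
  data Walk : V → V → Set ℓ where
    []  : ∀ {a} → Walk a a
    _∷_ : ∀ {a m m′ b c} → Edge a m m′ b → Walk b c → Walk a c

  nodes : ∀ {a b} → Walk a b → List V
  nodes {a} []      = a ∷ []
  nodes {a} (_ ∷ w) = a ∷ nodes w

  IsPath : ∀ {a b} → Walk a b → Set ℓ
  IsPath w = Unique (nodes w)

  IsDirected : ∀ {a b} → Walk a b → Set
  IsDirected []                       = ⊤
  IsDirected (_∷_ {m = m} {m′} _ w) = (m ≡ tail × m′ ≡ head) × IsDirected w

  IsAnterior : ∀ {a b} → Walk a b → Set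
  IsAnterior []                  = ⊤
  IsAnterior (_∷_ {m = m} _ w) = m ≡ tail × IsAnterior w

  Anc : V → Pred V ℓ
  Anc b a = Σ[ w ∈ Walk a b ] IsDirected w

  AncSet : Pred V ℓ → Pred V ℓ
  AncSet A a = ∃[ v ] v ∈ A × a ∈ Anc v

  Sc : V → Pred V ℓ
  Sc v w = w ∈ Anc v × v ∈ Anc w

  -- A predicate on a non-endpoint occurrence v on a walk, together with its
  -- two adjacent edges u –e– v –f– w on that walk.
  NodePred : Set (suc ℓ)
  NodePred = ∀ {u m₁ m₂ v m₃ m₄ w} → Edge u m₁ m₂ v → Edge v m₃ m₄ w → Set ℓ

  AllNonEndpoints : NodePred → ∀ {a b} → Walk a b → Set ℓ
  AllNonEndpoints P []            = ⊤
  AllNonEndpoints P (_ ∷ [])      = ⊤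
  AllNonEndpoints P (e ∷ f ∷ w) = P e f × AllNonEndpoints P (f ∷ w)

  Collider : ∀ {u m₁ m₂ v m₃ m₄ w} → Edge u m₁ m₂ v → Edge v m₃ m₄ w → Set
  Collider {m₂ = m₂} {m₃ = m₃} _ _ = m₂ ≡ head × m₃ ≡ head

  IsInducing : ∀ {a b} → Walk a b → Set ℓ
  IsInducing {a} {b} = AllNonEndpoints λ {_} {_} {_} {v} e f →
    Collider e f × v ∈ AncSet (｛ a ｝ ∪ ｛ b ｝)

  AnteriorPath : Rel V ℓ
  AnteriorPath a b = Σ[ w ∈ Walk a b ] IsPath w × IsAnterior w

  InducingPath : Rel V ℓ
  InducingPath a b = Σ[ w ∈ Walk a b ] IsPath w × IsInducing w

  record Simple : Set ℓ where
    field
      atMostOneEdge : ∀ {a b m₁ m₂ n₁ n₂} → a ≢ b →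
                      Edge a m₁ m₂ b → Edge a n₁ n₂ b → m₁ ≡ n₁ × m₂ ≡ n₂
      noSelfEdge    : ∀ {a} → ¬ Adjacent a a

  record IsσMAG : Set ℓ where
    field
      simple     : Simple
      ancestral  : ∀ {a b m} → AnteriorPath a b → ¬ Edge a head m b
      maximal    : ∀ {a b} → a ≢ b → ¬ Adjacent a b → ¬ InducingPath a b
      σ-complete : ∀ {a b c m} → Edge a m head b → b ── c →
                   Adjacent a c × (∀ {d} → b ── d → d ≢ c → Adjacent c d)

record DMG (N : Set ℓ) : Set (suc ℓ) where
  field
    graph : MixedGraph N
  open MixedGraph graph public
  field
    noUndirected   : ∀ {u v} → ¬ (u ── v)
    ⟶-distinct     : ∀ {u v} → u ⟶ v → u ≢ v
    ⟷-distinct     : ∀ {u v} → u ⟷ v → u ≢ v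

module _ {N : Set ℓ} (G : DMG N) where
  open DMG G using (graph)

  -- The first component covers an edge u ← v, the second an edge v → w.
  Unblockable : NodePred graph
  Unblockable {u} {m₁} {m₂} {v} {m₃} {m₄} {w} _ _ =
    (m₁ ≡ head × m₂ ≡ tail → u ∈ Sc graph v) ×
    (m₃ ≡ tail × m₄ ≡ head → w ∈ Sc graph v)

  Isσ-Inducing : Pred N ℓ → ∀ {a b} → Walk graph a b → Set ℓ
  Isσ-Inducing S {a} {b} = AllNonEndpoints graph λ {_} {_} {_} {v} e f →
    (Collider graph e f → v ∈ AncSet graph ((｛ a ｝ ∪ ｛ b ｝) ∪ S)) ×
    (¬ Collider graph e f → Unblockable e f)

  σ-InducingPath : Pred N ℓ → Rel N ℓ
  σ-InducingPath S a b = Σ[ w ∈ Walk graph a b ] IsPath graph w × Isσ-Inducing S w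

-- The disjoint union 𝒱 ∪ 𝒮 is V ⊎ S; its subset 𝒮 is the range of inj₂.
Selected : (V S : Set ℓ) → Pred (V ⊎ S) ℓ
Selected V S x = ∃[ s ] x ≡ inj₂ s

record Represents {V S : Set ℓ} (H : MixedGraph V) (G : DMG (V ⊎ S)) : Set ℓ where
  open DMG G using (graph)
  field
    simple       : Simple H
    adjacency    : ∀ {a b} → a ≢ b →
                   Adjacent H a b ⇔ σ-InducingPath G (Selected V S) (inj₁ a) (inj₁ b)
    nonAncestral : ∀ {a b m} → Edge H a head m b →
                   inj₁ a ∉ AncSet graph (｛ inj₁ b ｝ ∪ Selected V S)
    ancestral    : ∀ {a b m} → Edge H a tail m b →
                   inj₁ a ∈ AncSet graph (｛ inj₁ b ｝ ∪ Selected V S)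

{-# OPTIONS --safe #-}
-- A path between a and b is σ-inducing exactly when its nodes are all
-- ancestors of {a, b} ∪ 𝒮 and every tail on it is at a or b or stays inside a
-- strongly connected component.  These are conditions on single edges, so walks
-- satisfying them can be concatenated and cut down to paths.
-- If ℋ represents 𝒢, the σ-inducing paths of 𝒢 given by consecutive edges of ℋ
-- can be concatenated at a node into which there is an arrowhead, which yields
-- maximality and σ-completeness.  Conversely, in a σ-MAG an arrowhead into a node
-- is also into all nodes joined to it by undirected edges, and these form a
-- clique.  Let 𝒢 turn such cliques into strongly connected components and every
-- other undirected edge a − b into a → s ← b with s selected.  On a σ-inducing
-- path of 𝒢 between non-adjacent nodes, replacing the inner nodes by suitable
-- members of their cliques gives an inducing path of ℋ.
module Submission where

open import Axiom.ExcludedMiddle using (ExcludedMiddle)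
open import Data.Product.Base using (Σ-syntax)
open import Data.Sum.Base using (_⊎_)
open import Function.Bundles using (_⇔_)
open import Defs

open import Data.Empty using (⊥; ⊥-elim)
import Data.Empty.Polymorphic as Polymorphic
open import Data.List.Relation.Unary.All as All using (All; []; _∷_)
open import Data.List.Relation.Unary.All.Properties using (¬Any⇒All¬)
open import Data.List.Relation.Unary.AllPairs using ([]; _∷_)
open import Data.List.Relation.Unary.Any using (here; there)
open import Data.List.Membership.Propositional using () renaming (_∈_ to _∈ₗ_)
open import Data.Product.Base using (_×_; _,_; ∃-syntax; proj₁; proj₂)
open import Data.Sum.Base using (inj₁; inj₂; swap; map₁)
open import Data.Unit.Polymorphic.Base using (⊤)
open import Function.Base using (case_of_; _∘_)
open import Function.Bundles using (mk⇔; Equivalence)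
open import Level using (Level)
open import Relation.Binary.Core using (Rel)
open import Relation.Binary.Construct.Closure.ReflexiveTransitive
  using (Star; ε; _◅_; kleisliStar) renaming (map to mapStar)
open import Relation.Binary.PropositionalEquality.Core using (_≡_; _≢_; refl; sym)
open import Relation.Nullary.Decidable.Core using (yes; no)
open import Relation.Nullary.Negation.Core using (¬_)
open import Relation.Unary using (Pred; _∈_; _∉_; _⊆_; _∪_; ｛_｝)

private
  variable
    ℓ q : Level

-- Ancestors, and cutting walks down to paths

module _ {V : Set ℓ} (H : MixedGraph V) where
  open MixedGraph H

  flip-edge : ∀ {a m m′ b} → Edge H a m m′ b → Edge H b m′ m a
  flip-edge (right e) = left e
  flip-edge (left e)  = right e
  flip-edge (bidir e) = bidir (⟷-sym e)
  flip-edge (undir e) = undir (──-sym e)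

  anc-refl : ∀ {a} → a ∈ Anc H a
  anc-refl = [] , _

  anc-step : ∀ {a b c} → a ⟶ b → b ∈ Anc H c → a ∈ Anc H c
  anc-step e (w , d) = right e ∷ w , (refl , refl) , d

  private
    anc-append : ∀ {a b c} (w : Walk H a b) → IsDirected H w → b ∈ Anc H c → a ∈ Anc H c
    anc-append []            _                 p = p
    anc-append (right e ∷ w) (_ , d)           p = anc-step e (anc-append w d p)
    anc-append (left _ ∷ _)  ((() , _) , _)    p
    anc-append (bidir _ ∷ _) ((() , _) , _)    p
    anc-append (undir _ ∷ _) ((_ , ()) , _)    p

  anc-trans : ∀ {a b c} → a ∈ Anc H b → b ∈ Anc H c → a ∈ Anc H c
  anc-trans (w , d) = anc-append w d

  ancSet-step : ∀ {a b A} → a ⟶ b → b ∈ AncSet H A → a ∈ AncSet H A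
  ancSet-step e (v , v∈A , p) = v , v∈A , anc-step e p

  ancSet-bind : ∀ {A B} → A ⊆ AncSet H B → AncSet H A ⊆ AncSet H B
  ancSet-bind A⊆B (v , v∈A , p) with A⊆B v∈A
  ... | u , u∈B , r = u , u∈B , anc-trans p r

  ancSet-mono : ∀ {A B : Pred V ℓ} → A ⊆ B → AncSet H A ⊆ AncSet H B
  ancSet-mono A⊆B (v , v∈A , p) = v , A⊆B v∈A , p

  ∈⇒ancSet : ∀ {A} → A ⊆ AncSet H A
  ∈⇒ancSet v∈A = _ , v∈A , anc-refl

  Step : (V → Mark → Mark → V → Set q) → V → V → Set _
  Step Q a b = ∃[ m ] ∃[ m′ ] Edge H a m m′ b × Q a m m′ b

  AllEdges : (V → Mark → Mark → V → Set q) → ∀ {a b} → Walk H a b → Set q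
  AllEdges Q []                                = ⊤
  AllEdges Q (_∷_ {a = a} {m} {m′} {b} _ w) = Q a m m′ b × AllEdges Q w

  module _ {Q : V → Mark → Mark → V → Set q} where

    private
      suffixFrom : ∀ {a b x} (w : Walk H a b) → IsPath H w → AllEdges Q w → x ∈ₗ nodes H w →
                   Σ[ w′ ∈ Walk H x b ] IsPath H w′ × AllEdges Q w′
      suffixFrom []      u       qs (here refl) = [] , u , qs
      suffixFrom (e ∷ w) u       qs (here refl) = e ∷ w , u , qs
      suffixFrom (e ∷ w) (_ ∷ u) qs (there i)   = suffixFrom w u (proj₂ qs) i

    -- Loop erasure: if the new first node already occurs on the path, only the suffix from there is
    -- kept.
    toPath : ExcludedMiddle ℓ → ∀ {a b} → Star (Step Q) a b →
             Σ[ w ∈ Walk H a b ] IsPath H w × AllEdges Q w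
    toPath em ε = [] , [] ∷ [] , _
    toPath em {a} ((_ , _ , e , q) ◅ s) with toPath em s
    ... | w , u , qs with em {a ∈ₗ nodes H w}
    ...   | yes a∈w = suffixFrom w u qs a∈w
    ...   | no  a∉w = e ∷ w , ¬Any⇒All¬ _ a∉w ∷ u , q , qs

    end∈nodes : ∀ {a b} (w : Walk H a b) → b ∈ₗ nodes H w
    end∈nodes []      = here refl
    end∈nodes (_ ∷ w) = there (end∈nodes w)

    module _ {a b} (P : NodePred H)
      (local : ∀ {u m₁ m₂ v m₃ m₄ w} (e : Edge H u m₁ m₂ v) (f : Edge H v m₃ m₄ w) →
               Q u m₁ m₂ v → Q v m₃ m₄ w → v ≢ a → v ≢ b → P e f)
      where

      private
        interior : ∀ {x m m′ y} (e : Edge H x m m′ y) (w : Walk H y b) →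
                   All (a ≢_) (nodes H w) → IsPath H w →
                   AllEdges Q (e ∷ w) → AllNonEndpoints H P (e ∷ w)
        interior e []      _        _         _             = _
        interior e (f ∷ w) (a≢v ∷ a∉w) (v∉w ∷ u) (q , q′ , qs) =
          local e f q q′ (a≢v ∘ sym) (All.lookup v∉w (end∈nodes w)) ,
          interior f w a∉w u (q′ , qs)

      -- On a path no inner node equals `a` or `b`, so exceptions that `Q` grants at these two nodes
      -- do no harm.
      path-nonEndpoints : (w : Walk H a b) → IsPath H w → AllEdges Q w → AllNonEndpoints H P w
      path-nonEndpoints []      _         _  = _
      path-nonEndpoints (e ∷ w) (a∉w ∷ u) qs = interior e w a∉w u qs

-- σ-inducing paths through conditions on single edges

module Localσ {N : Set ℓ} (G : DMG N) (Sel : Pred N ℓ) where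
  open DMG G

  private
    Γ = graph

  Ends : N → N → Pred N ℓ
  Ends a b = ｛ a ｝ ∪ ｛ b ｝

  A : N → N → Pred N ℓ
  A a b = AncSet Γ (Ends a b ∪ Sel)

  -- "m at x" on an edge between x and y: a tail may only leave an end node,
  -- or stay inside the strongly connected component.
  Half : N → N → N → Mark → N → Set ℓ
  Half a b x m y = m ≡ tail → x ∈ Ends a b ⊎ y ∈ Sc Γ x

  -- Unlike σ-inducingness, this condition concerns single edges, so it is
  -- inherited by every walk made of the same edges.
  Local : N → N → N → Mark → Mark → N → Set ℓ
  Local a b x m m′ y =
    (x ∈ A a b × y ∈ A a b) × Half a b x m y × Half a b y m′ x

  tail⇒arrow : ∀ {x m y} → Edge Γ x tail m y → x ⟶ y × m ≡ head
  tail⇒arrow (right e) = e , refl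
  tail⇒arrow (undir e) = ⊥-elim (noUndirected e)

  module _ {a b : N} where

    private
      Nodeσ : NodePred Γ
      Nodeσ {_} {_} {_} {v} e f =
        (Collider Γ e f → v ∈ A a b) × (¬ Collider Γ e f → Unblockable G e f)

      b∈A : b ∈ A a b
      b∈A = ∈⇒ancSet Γ (inj₁ (inj₂ refl))

      -- A directed stretch of the walk ends in a collider or in b.
      tail⇒∈A : ∀ {x y} (e : x ⟶ y) (w : Walk Γ y b) →
                AllNonEndpoints Γ Nodeσ (right e ∷ w) → x ∈ A a b
      tail⇒∈A e []            _             = ancSet-step Γ e b∈A
      tail⇒∈A e (right f ∷ w) (_ , ps)      = ancSet-step Γ e (tail⇒∈A f w ps)
      tail⇒∈A e (left f ∷ w)  ((c , _) , _) = ancSet-step Γ e (c (refl , refl))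
      tail⇒∈A e (bidir f ∷ w) ((c , _) , _) = ancSet-step Γ e (c (refl , refl))
      tail⇒∈A e (undir f ∷ w) _             = ⊥-elim (noUndirected f)

      next∈A : ∀ {x m₁ m₂ y m₃ m₄ z} (e : Edge Γ x m₁ m₂ y) (f : Edge Γ y m₃ m₄ z)
               (w : Walk Γ z b) → x ∈ A a b → AllNonEndpoints Γ Nodeσ (e ∷ f ∷ w) → y ∈ A a b
      next∈A (left e)  _         w x∈A _             = ancSet-step Γ e x∈A
      next∈A (undir e) _         w x∈A _             = ⊥-elim (noUndirected e)
      next∈A (right _) (right f) w x∈A (_ , ps)      = tail⇒∈A f w ps
      next∈A (right _) (left _)  w x∈A ((c , _) , _) = c (refl , refl)
      next∈A (right _) (bidir _) w x∈A ((c , _) , _) = c (refl , refl)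
      next∈A (bidir _) (right f) w x∈A (_ , ps)      = tail⇒∈A f w ps
      next∈A (bidir _) (left _)  w x∈A ((c , _) , _) = c (refl , refl)
      next∈A (bidir _) (bidir _) w x∈A ((c , _) , _) = c (refl , refl)
      next∈A _         (undir f) w x∈A _             = ⊥-elim (noUndirected f)

      localise : ∀ {x m m′ y} (e : Edge Γ x m m′ y) (w : Walk Γ y b) →
                 x ∈ A a b → Half a b x m y → AllNonEndpoints Γ Nodeσ (e ∷ w) →
                 Star (Step Γ (Local a b)) x b
      localise e [] x∈A hx _ =
        (_ , _ , e , (x∈A , b∈A) , hx , λ _ → inj₁ (inj₂ refl)) ◅ ε
      localise e (f ∷ w) x∈A hx ps@((_ , unblockable) , ps′) =
        (_ , _ , e , (x∈A , y∈A) , hx ,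
          -- A tail at `y` makes `y` a non-collider, hence unblockable; the far mark is an arrowhead
          -- because a DMG has no undirected edges.
          λ { refl → inj₂ (proj₁ (unblockable λ ()) (proj₂ (tail⇒arrow (flip-edge Γ e)) , refl)) })
        ◅ localise f w y∈A
          (λ { refl → inj₂ (proj₂ (unblockable λ ()) (refl , proj₂ (tail⇒arrow f))) }) ps′
        where y∈A = next∈A e f w x∈A ps

    σ-inducing⇒local : (w : Walk Γ a b) → Isσ-Inducing G Sel w → Star (Step Γ (Local a b)) a b
    σ-inducing⇒local []      _  = ε
    σ-inducing⇒local (e ∷ w) ps =
      localise e w (∈⇒ancSet Γ (inj₁ (inj₁ refl))) (λ _ → inj₁ (inj₁ refl)) ps

    local⇒σ-inducingPath : ExcludedMiddle ℓ →
                           Star (Step Γ (Local a b)) a b → σ-InducingPath G Sel a b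
    local⇒σ-inducingPath em s with toPath Γ em s
    ... | w , path , qs = w , path , path-nonEndpoints Γ Nodeσ node w path qs
      where
      half⇒Sc : ∀ {x m y} → x ≢ a → x ≢ b → Half a b x m y → m ≡ tail → y ∈ Sc Γ x
      half⇒Sc x≢a x≢b h m≡tail with h m≡tail
      ... | inj₁ (inj₁ a≡x) = ⊥-elim (x≢a (sym a≡x))
      ... | inj₁ (inj₂ b≡x) = ⊥-elim (x≢b (sym b≡x))
      ... | inj₂ y∈Sc       = y∈Sc

      node : ∀ {u m₁ m₂ v m₃ m₄ w} (e : Edge Γ u m₁ m₂ v) (f : Edge Γ v m₃ m₄ w) →
             Local a b u m₁ m₂ v → Local a b v m₃ m₄ w → v ≢ a → v ≢ b → Nodeσ e f
      node e f ((_ , v∈A) , _ , h) (_ , h′ , _) v≢a v≢b =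
        (λ _ → v∈A) ,
        (λ _ → (λ (_ , t) → half⇒Sc v≢a v≢b h t) , (λ (t , _) → half⇒Sc v≢a v≢b h′ t))

-- Graphs that represent a DMG are σ-MAGs

module Represented (em : ExcludedMiddle ℓ) {V S : Set ℓ} {H : MixedGraph V}
                   {G : DMG (V ⊎ S)} (represents : Represents H G) where
  open DMG G using (graph; _⟶_)
  open MixedGraph H using (_──_)
  open Represents represents
  open Simple simple

  private
    Sel = Selected V S
    Γ = graph
  open Localσ G Sel

  -- At such a u, no tail of a σ-inducing path to v leaves the strongly
  -- connected component of u.
  Tame : V → V → Set ℓ
  Tame u v = inj₁ u ∉ AncSet Γ Sel ×
             (inj₁ u ∈ Anc Γ (inj₁ v) → inj₁ v ∈ Anc Γ (inj₁ u))

  -- What lets the σ-inducing path behind an edge of `H` serve as a stretch of a walk from `a` to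
  -- `b`: its nodes stay ancestors, and its tails at `u` and `v` are harmless.
  Link : V → V → V → V → Set ℓ
  Link a b u v =
    Adjacent H u v × (inj₁ u ∈ A (inj₁ a) (inj₁ b) × inj₁ v ∈ A (inj₁ a) (inj₁ b)) ×
    (inj₁ u ∈ Ends (inj₁ a) (inj₁ b) ⊎ Tame u v) × (inj₁ v ∈ Ends (inj₁ a) (inj₁ b) ⊎ Tame v u)

  -- If `y` is an ancestor of `u`, the cycle closes at once. If `y` is an ancestor of `v`, so is
  -- `u`, and tameness leads back from `v` to `u`. Tameness excludes selected nodes.
  tame-Sc : ∀ {u v y} → Tame u v → inj₁ u ⟶ y → y ∈ A (inj₁ u) (inj₁ v) → y ∈ Sc Γ (inj₁ u)
  tame-Sc _           e (_ , inj₁ (inj₁ refl) , p) = p , anc-step Γ e (anc-refl Γ)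
  tame-Sc (_ , back)  e (_ , inj₁ (inj₂ refl) , p) =
    anc-trans Γ p (back (anc-step Γ e p)) , anc-step Γ e (anc-refl Γ)
  tame-Sc (u∉S , _)   e (s , inj₂ s∈S , p) = ⊥-elim (u∉S (s , s∈S , anc-step Γ e p))

  A-swap : ∀ {u v} → A u v ⊆ A v u
  A-swap = ancSet-mono Γ (map₁ swap)

  A-⊆ : ∀ {a b u v} → u ∈ A a b → v ∈ A a b → A u v ⊆ A a b
  A-⊆ u∈A v∈A = ancSet-bind Γ λ where
    (inj₁ (inj₁ refl)) → u∈A
    (inj₁ (inj₂ refl)) → v∈A
    (inj₂ s∈S)         → ∈⇒ancSet Γ (inj₂ s∈S)

  private
    relocate-half : ∀ {a b u v x m m′ y} →
      inj₁ u ∈ Ends a b ⊎ Tame u v → inj₁ v ∈ Ends a b ⊎ Tame v u →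
      y ∈ A (inj₁ u) (inj₁ v) → Edge Γ x m m′ y →
      Half (inj₁ u) (inj₁ v) x m y → Half a b x m y
    relocate-half cu cv y∈A e h refl with h refl | cu | cv
    ... | inj₂ y∈Sc        | _          | _          = inj₂ y∈Sc
    ... | inj₁ (inj₁ refl) | inj₁ u∈E   | _          = inj₁ u∈E
    ... | inj₁ (inj₁ refl) | inj₂ tame  | _          = inj₂ (tame-Sc tame (proj₁ (tail⇒arrow e)) y∈A)
    ... | inj₁ (inj₂ refl) | _          | inj₁ v∈E   = inj₁ v∈E
    ... | inj₁ (inj₂ refl) | _          | inj₂ tame  =
      inj₂ (tame-Sc tame (proj₁ (tail⇒arrow e)) (A-swap y∈A))

  link⇒local : ∀ {a b u v} → Link a b u v →
               Star (Step Γ (Local (inj₁ a) (inj₁ b))) (inj₁ u) (inj₁ v)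
  link⇒local ((m , m′ , e) , (u∈A , v∈A) , cu , cv)
    with Equivalence.to (adjacency (λ { refl → noSelfEdge (m , m′ , e) })) (m , m′ , e)
  ... | w , _ , ind = mapStar relocate (σ-inducing⇒local w ind)
    where
    relocate : ∀ {x y} → Step Γ (Local _ _) x y → Step Γ (Local _ _) x y
    relocate (_ , _ , f , (x∈A , y∈A) , h , h′) =
      _ , _ , f , (A-⊆ u∈A v∈A x∈A , A-⊆ u∈A v∈A y∈A) ,
      relocate-half cu cv y∈A f h , relocate-half cu cv x∈A (flip-edge Γ f) h′

  links⇒adjacent : ∀ {a b} → a ≢ b → Star (Link a b) a b → Adjacent H a b
  links⇒adjacent a≢b s =
    Equivalence.from (adjacency a≢b) (local⇒σ-inducingPath em (kleisliStar inj₁ link⇒local s))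

  anterior⇒ancestor : ∀ {a b} (w : Walk H a b) → IsAnterior H w →
                      inj₁ a ∈ AncSet Γ (｛ inj₁ b ｝ ∪ Sel)
  anterior⇒ancestor []      _            = ∈⇒ancSet Γ (inj₁ refl)
  anterior⇒ancestor (e ∷ w) (refl , ant) = ancSet-bind Γ
    (λ where
      (inj₁ refl) → anterior⇒ancestor w ant
      (inj₂ s∈S)  → ∈⇒ancSet Γ (inj₂ s∈S))
    (ancestral e)

  directed⇒anterior : ∀ {a b} (w : Walk H a b) → IsDirected H w → IsAnterior H w
  directed⇒anterior []      _             = _
  directed⇒anterior (_ ∷ w) ((t , _) , d) = t , directed⇒anterior w d

  -- The arrowhead keeps `a` from being an ancestor of `b`, so the second half of `Tame` is vacuous.
  head⇒tame : ∀ {a m b} → Edge H a head m b → Tame a b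
  head⇒tame e =
    (λ (s , s∈S , p) → nonAncestral e (s , inj₂ s∈S , p)) ,
    (λ p → ⊥-elim (nonAncestral e (_ , inj₁ refl , p)))

  H-ancestor⇒A : ∀ {a b v} → v ∈ AncSet H (｛ a ｝ ∪ ｛ b ｝) → inj₁ v ∈ A (inj₁ a) (inj₁ b)
  H-ancestor⇒A (_ , t∈E , w , d) =
    ancSet-mono Γ (λ where
      (inj₁ refl) → inj₁ (lift t∈E)
      (inj₂ s∈S)  → inj₂ s∈S)
    (anterior⇒ancestor w (directed⇒anterior w d))
    where
    lift : ∀ {a b t} → t ∈ ｛ a ｝ ∪ ｛ b ｝ → inj₁ t ∈ Ends (inj₁ a) (inj₁ b)
    lift (inj₁ refl) = inj₁ refl
    lift (inj₂ refl) = inj₂ refl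

  -- Every inner node is a collider, hence tame towards both neighbours; the exception for ends
  -- serves only `a` and `b`.
  inducing⇒links : ∀ {a b} (w : Walk H a b) → IsInducing H w → Star (Link a b) a b
  inducing⇒links []      _  = ε
  inducing⇒links {a} {b} (e ∷ w) ps =
    links e w (∈⇒ancSet Γ (inj₁ (inj₁ refl))) (inj₁ (inj₁ refl)) ps
    where
    links : ∀ {x m m′ y} (e : Edge H x m m′ y) (w : Walk H y b) →
            inj₁ x ∈ A (inj₁ a) (inj₁ b) →
            inj₁ x ∈ Ends (inj₁ a) (inj₁ b) ⊎ Tame x y →
            AllNonEndpoints H (λ {_} {_} {_} {v} e f →
              Collider H e f × v ∈ AncSet H (｛ a ｝ ∪ ｛ b ｝)) (e ∷ w) →
            Star (Link a b) x b
    links e [] x∈A cx _ =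
      ((_ , _ , e) , (x∈A , ∈⇒ancSet Γ (inj₁ (inj₂ refl))) , cx , inj₁ (inj₂ refl)) ◅ ε
    links e (f ∷ w) x∈A cx (((refl , refl) , v∈Anc) , ps) =
      ((_ , _ , e) , (x∈A , H-ancestor⇒A v∈Anc) , cx , inj₂ (head⇒tame (flip-edge H e)))
      ◅ links f w (H-ancestor⇒A v∈Anc) (inj₂ (head⇒tame f)) ps

  -- Each end is an ancestor of the other or of a selected node; the latter is impossible for `b`,
  -- hence also for its descendant `c`.
  undirected⇒Sc : ∀ {b c} → inj₁ b ∉ AncSet Γ Sel → b ── c → inj₁ c ∈ Sc Γ (inj₁ b)
  undirected⇒Sc {b} {c} b∉S e with ancestral (undir e) | ancestral (flip-edge H (undir e))
  ... | _ , inj₂ s∈S , p  | _                    = ⊥-elim (b∉S (_ , s∈S , p))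
  ... | _ , inj₁ refl , p | _ , inj₂ s∈S , r     = ⊥-elim (b∉S (_ , s∈S , anc-trans Γ p r))
  ... | _ , inj₁ refl , p | _ , inj₁ refl , r    = r , p

  isσMAG : IsσMAG H
  isσMAG = record
    { simple     = simple
    ; ancestral  = λ (w , _ , ant) e → nonAncestral e (anterior⇒ancestor w ant)
    ; maximal    = λ a≢b ¬adj (w , _ , ind) → ¬adj (links⇒adjacent a≢b (inducing⇒links w ind))
    ; σ-complete = complete
    }
    where
    complete : ∀ {a b c m} → Edge H a m head b → b ── c →
               Adjacent H a c × (∀ {d} → b ── d → d ≢ c → Adjacent H c d)
    complete {a} {b} {c} e f =
      -- The two links meet at `b`, which is tame towards `a` by the arrowhead and towards `c` by
      -- their common strongly connected component.
      links⇒adjacent a≢c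
        ( ((_ , _ , e) , (a∈A , via f) , inj₁ (inj₁ refl) , inj₂ (head⇒tame (flip-edge H e)))
        ◅ ((_ , _ , undir f) , (via f , ∈⇒ancSet Γ (inj₁ (inj₂ refl))) , inj₂ (tame f) , inj₁ (inj₂ refl))
        ◅ ε) ,
      λ {d} g d≢c → links⇒adjacent (d≢c ∘ sym)
        ( ((_ , _ , flip-edge H (undir f)) , (∈⇒ancSet Γ (inj₁ (inj₁ refl)) , via g) ,
            inj₁ (inj₁ refl) , inj₂ (tame f))
        ◅ ((_ , _ , undir g) , (via g , ∈⇒ancSet Γ (inj₁ (inj₂ refl))) , inj₂ (tame g) , inj₁ (inj₂ refl))
        ◅ ε)
      where
      b∉S : inj₁ b ∉ AncSet Γ Sel
      b∉S = proj₁ (head⇒tame (flip-edge H e))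

      tame : ∀ {d} → b ── d → Tame b d
      tame g = b∉S , λ _ → proj₁ (undirected⇒Sc b∉S g)

      via : ∀ {x d} → b ── d → inj₁ b ∈ A x (inj₁ d)
      via g = _ , inj₁ (inj₂ refl) , proj₂ (undirected⇒Sc b∉S g)

      a∈A : ∀ {x} → inj₁ a ∈ A (inj₁ a) x
      a∈A = ∈⇒ancSet Γ (inj₁ (inj₁ refl))

      a≢c : a ≢ c
      a≢c refl with atMostOneEdge (λ { refl → noSelfEdge (_ , _ , e) }) e (undir (MixedGraph.──-sym H f))
      ... | _ , ()

-- Arrowheads and undirected cliques in a σ-MAG

module Canonical (em : ExcludedMiddle ℓ) {V : Set ℓ} {H : MixedGraph V} (mag : IsσMAG H) where
  open MixedGraph H
  open IsσMAG mag
  open Simple simple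

  Anterior : V → V → Set ℓ
  Anterior = Star (Step H λ _ m _ _ → m ≡ tail)

  _◂_ : ∀ {a m b c} → Edge H a tail m b → Anterior b c → Anterior a c
  e ◂ s = (_ , _ , e , refl) ◅ s
  infixr 5 _◂_

  anterior⇒no-head : ∀ {a b m} → Anterior a b → ¬ Edge H a head m b
  anterior⇒no-head s with toPath H em s
  ... | w , path , qs = ancestral (w , path , isAnterior w qs)
    where
    isAnterior : ∀ {a b} (w : Walk H a b) → AllEdges H (λ _ m _ _ → m ≡ tail) w → IsAnterior H w
    isAnterior []      _        = _
    isAnterior (_ ∷ w) (t , qs) = t , isAnterior w qs

  Headed : Pred V ℓ
  Headed b = ∃[ a ] ∃[ m ] Edge H a m head b

  -- σ-completeness makes `a` and `c` adjacent; marks other than those of the given edge would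
  -- produce an anterior walk against an arrowhead.
  head-transfer : ∀ {a b c m} → Edge H a m head b → b ── c → Edge H a m head c
  head-transfer e f with σ-complete e f
  head-transfer {m = m} e f | (n , tail , g) , _ =
    ⊥-elim (anterior⇒no-head (undir f ◂ flip-edge H g ◂ ε) (flip-edge H e))
  head-transfer {m = tail} e f | (tail , head , g) , _ = g
  head-transfer {m = head} e f | (head , head , g) , _ = g
  head-transfer {m = tail} e f | (head , head , g) , _ =
    ⊥-elim (anterior⇒no-head (e ◂ undir f ◂ ε) g)
  head-transfer {m = head} e f | (tail , head , g) , _ =
    ⊥-elim (anterior⇒no-head (g ◂ undir (──-sym f) ◂ ε) e)

  headed-transfer : ∀ {b c} → Headed b → b ── c → Headed c
  headed-transfer (_ , _ , e) f = _ , _ , head-transfer e f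

  -- An arrowhead between `c` and `d` would contradict the anterior walk through `b`.
  clique : ∀ {b c d} → Headed b → b ── c → b ── d → c ≢ d → c ── d
  clique (_ , _ , e) f g c≢d with proj₂ (σ-complete e f) g (c≢d ∘ sym)
  ... | _ , _ , undir h = h
  ... | _ , _ , right h = ⊥-elim (anterior⇒no-head (undir (──-sym g) ◂ undir f ◂ ε) (left h))
  ... | _ , _ , left h  = ⊥-elim (anterior⇒no-head (undir (──-sym f) ◂ undir g ◂ ε) (left h))
  ... | _ , _ , bidir h = ⊥-elim (anterior⇒no-head (undir (──-sym f) ◂ undir g ◂ ε) (bidir h))

  infix 4 _≈_
  -- On headed nodes this is the equivalence relation whose classes are the cliques.
  _≈_ : Rel V ℓ
  x ≈ y = x ≡ y ⊎ x ── y

  head-transfer-≈ : ∀ {a b c m} → Edge H a m head b → b ≈ c → Edge H a m head c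
  head-transfer-≈ e (inj₁ refl) = e
  head-transfer-≈ e (inj₂ f)    = head-transfer e f

  ≈-cons : ∀ {x y z} → Headed y → x ── y → y ≈ z → x ≈ z
  ≈-cons hy f (inj₁ refl) = inj₂ f
  ≈-cons {x} {z = z} hy f (inj₂ g) with em {x ≡ z}
  ... | yes x≡z = inj₁ x≡z
  ... | no  x≢z = inj₂ (clique hy (──-sym f) g x≢z)

  -- An undirected stretch after an arrow is absorbed by moving the arrowhead within its clique; an
  -- initial one is absorbed by the choice of `r`.
  headed-anterior⇒≈-ancestor : ∀ {x t} → Headed x → Anterior x t → ∃[ r ] x ≈ r × r ∈ Anc H t
  headed-anterior⇒≈-ancestor hx ε = _ , inj₁ refl , anc-refl H
  headed-anterior⇒≈-ancestor hx ((_ , _ , right e , refl) ◅ s)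
    with headed-anterior⇒≈-ancestor (_ , _ , right e) s
  ... | r , y≈r , p with head-transfer-≈ (right e) y≈r
  ...   | right e′ = _ , inj₁ refl , anc-step H e′ p
  headed-anterior⇒≈-ancestor hx ((_ , _ , undir e , refl) ◅ s)
    with headed-anterior⇒≈-ancestor (headed-transfer hx e) s
  ... | r , y≈r , p = r , ≈-cons (headed-transfer hx e) e y≈r , p

  -- The canonical DMG and its ancestors

  S : Set ℓ
  S = Σ[ x ∈ V ] Σ[ y ∈ V ] x ── y × ¬ Headed x

  -- Undirected edges between headed nodes form cliques, which become strongly
  -- connected components; the other ones are explained by selection.
  data _⟶ᴳ_ : V ⊎ S → V ⊎ S → Set ℓ where
    arrow : ∀ {a b} → a ⟶ b → inj₁ a ⟶ᴳ inj₁ b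
    cycle : ∀ {a b} → a ── b → Headed a → inj₁ a ⟶ᴳ inj₁ b
    sel₁  : ∀ {x y p} → inj₁ x ⟶ᴳ inj₂ (x , y , p)
    sel₂  : ∀ {x y p} → inj₁ y ⟶ᴳ inj₂ (x , y , p)

  data _⟷ᴳ_ : V ⊎ S → V ⊎ S → Set ℓ where
    bidirected : ∀ {a b} → a ⟷ b → inj₁ a ⟷ᴳ inj₁ b

  G : DMG (V ⊎ S)
  G = record
    { graph = record
      { _⟶_    = _⟶ᴳ_
      ; _⟷_    = _⟷ᴳ_
      ; _──_   = λ _ _ → Polymorphic.⊥
      ; ⟷-sym  = λ { (bidirected e) → bidirected (⟷-sym e) }
      ; ──-sym = λ ()
      }
    ; noUndirected = λ ()
    ; ⟶-distinct = λ where
        (arrow e) refl   → noSelfEdge (_ , _ , right e)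
        (cycle e _) refl → noSelfEdge (_ , _ , undir e)
    ; ⟷-distinct = λ { (bidirected e) refl → noSelfEdge (_ , _ , bidir e) }
    }

  private
    Γ = DMG.graph G
    Sel = Selected V S
  open Localσ G Sel

  sel-sink : ∀ {s x} → inj₂ s ∉ Anc Γ (inj₁ x)
  sel-sink (right () ∷ _ , _)
  sel-sink (left _ ∷ _ , (() , _) , _)
  sel-sink (bidir _ ∷ _ , (() , _) , _)

  ancestor⇒anterior : ∀ {x y} (w : Walk Γ (inj₁ x) (inj₁ y)) → IsDirected Γ w → Anterior x y
  ancestor⇒anterior [] _ = ε
  ancestor⇒anterior (right (arrow e) ∷ w)   (_ , d) = right e ◂ ancestor⇒anterior w d
  ancestor⇒anterior (right (cycle e _) ∷ w) (_ , d) = undir e ◂ ancestor⇒anterior w d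
  ancestor⇒anterior (right sel₁ ∷ w)        (_ , d) = ⊥-elim (sel-sink (w , d))
  ancestor⇒anterior (right sel₂ ∷ w)        (_ , d) = ⊥-elim (sel-sink (w , d))
  ancestor⇒anterior (left _ ∷ _)  ((() , _) , _)
  ancestor⇒anterior (bidir _ ∷ _) ((() , _) , _)

  -- Headedness persists along directed edges between nodes of `V`, while selected nodes have only
  -- headless parents.
  headed⇒not-selected : ∀ {x s} → Headed x → (w : Walk Γ (inj₁ x) (inj₂ s)) → ¬ IsDirected Γ w
  headed⇒not-selected hx (right (arrow e) ∷ w)   (_ , d) = headed⇒not-selected (_ , _ , right e) w d
  headed⇒not-selected hx (right (cycle e _) ∷ w) (_ , d) = headed⇒not-selected (headed-transfer hx e) w d
  headed⇒not-selected hx (right (sel₁ {p = _ , ¬h}) ∷ _) _ = ¬h hx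
  headed⇒not-selected hx (right (sel₂ {p = e , ¬h}) ∷ _) _ = ¬h (headed-transfer hx (──-sym e))
  headed⇒not-selected hx (left _ ∷ _)  ((() , _) , _)
  headed⇒not-selected hx (bidir _ ∷ _) ((() , _) , _)

  -- No σ-inducing path between non-adjacent nodes

  module _ {a b : V} (a≢b : a ≢ b) (¬adj : ¬ Adjacent H a b) where

    private
      E : Pred V ℓ
      E = ｛ a ｝ ∪ ｛ b ｝

      -- The counterpart in `H` of `Local`: walks of such edges from `a` to `b` cut down to inducing
      -- paths.
      InducingLocal : V → Mark → Mark → V → Set ℓ
      InducingLocal x m m′ y =
        (x ∈ AncSet H E × y ∈ AncSet H E) × (m ≡ tail → x ∈ E) × (m′ ≡ tail → y ∈ E)

      InducingWalk : Rel V ℓ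
      InducingWalk = Star (Step H InducingLocal)

      no-inducingWalk : ¬ InducingWalk a b
      no-inducingWalk s with toPath H em s
      ... | w , path , qs = maximal a≢b ¬adj (w , path , path-nonEndpoints H _ node w path qs)
        where
        interior-head : ∀ {v m} → v ≢ a → v ≢ b → (m ≡ tail → v ∈ E) → m ≡ head
        interior-head {m = head} v≢a v≢b h = refl
        interior-head {m = tail} v≢a v≢b h with h refl
        ... | inj₁ a≡v = ⊥-elim (v≢a (sym a≡v))
        ... | inj₂ b≡v = ⊥-elim (v≢b (sym b≡v))

        node : ∀ {u m₁ m₂ v m₃ m₄ w} (e : Edge H u m₁ m₂ v) (f : Edge H v m₃ m₄ w) →
               InducingLocal u m₁ m₂ v → InducingLocal v m₃ m₄ w → v ≢ a → v ≢ b →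
               Collider H e f × v ∈ AncSet H E
        node e f ((_ , v∈Anc) , _ , h) (_ , h′ , _) v≢a v≢b =
          (interior-head v≢a v≢b h , interior-head v≢a v≢b h′) , v∈Anc

      -- As its first edge has an arrowhead at x, such a walk can be moved to
      -- any other node of the clique of x.
      Chain : Pred V ℓ
      Chain x = ∃[ y ] ∃[ m ] Edge H x head m y × (m ≡ tail → y ∈ E) ×
                y ∈ AncSet H E × InducingWalk y b

      -- The invariant carried backwards from `b` along a local walk of `G`. It does not ask `x`
      -- itself to be an ancestor in `H`, since only some member of its clique need be one.
      Reaches : Pred V ℓ
      Reaches x = x ≈ b ⊎ Chain x

      chain-transfer : ∀ {x y} → x ≈ y → Chain x → Chain y
      chain-transfer x≈y (z , m , e , h) =
        z , m , flip-edge H (head-transfer-≈ (flip-edge H e) x≈y) , h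

      chain⇒headed : ∀ {x} → Chain x → Headed x
      chain⇒headed (_ , _ , e , _) = _ , _ , flip-edge H e

      chain⇒walk : ∀ {x} → x ∈ AncSet H E → Chain x → InducingWalk x b
      chain⇒walk x∈Anc (_ , _ , e , h , y∈Anc , s) =
        (_ , _ , e , (x∈Anc , y∈Anc) , (λ ()) , h) ◅ s

      end∈Anc : ∀ {x} → x ∈ E → x ∈ AncSet H E
      end∈Anc = ∈⇒ancSet H

      ¬reaches-a : ¬ Reaches a
      ¬reaches-a (inj₁ (inj₁ a≡b)) = a≢b a≡b
      ¬reaches-a (inj₁ (inj₂ e))   = ¬adj (_ , _ , undir e)
      ¬reaches-a (inj₂ c)          = no-inducingWalk (chain⇒walk (end∈Anc (inj₁ refl)) c)

      representative : ∀ {x} → Headed x → inj₁ x ∈ A (inj₁ a) (inj₁ b) →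
                       ∃[ r ] x ≈ r × r ∈ AncSet H E
      representative hx (_ , inj₂ (_ , refl) , w , d) = ⊥-elim (headed⇒not-selected hx w d)
      representative hx (_ , inj₁ (inj₁ refl) , w , d)
        with headed-anterior⇒≈-ancestor hx (ancestor⇒anterior w d)
      ... | r , x≈r , p = r , x≈r , a , inj₁ refl , p
      representative hx (_ , inj₁ (inj₂ refl) , w , d)
        with headed-anterior⇒≈-ancestor hx (ancestor⇒anterior w d)
      ... | r , x≈r , p = r , x≈r , b , inj₂ refl , p

      -- The edge is redirected within the clique of `y`, either to `b` or to a member that is an
      -- ancestor in `H` and can continue the chain.
      attach : ∀ {x m y} → Edge H x m head y → inj₁ y ∈ A (inj₁ a) (inj₁ b) → Reaches y →
               ∃[ r ] Edge H x m head r × r ∈ AncSet H E × InducingWalk r b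
      attach e y∈A (inj₁ y≈b) = b , head-transfer-≈ e y≈b , end∈Anc (inj₂ refl) , ε
      attach e y∈A (inj₂ c) with representative (chain⇒headed c) y∈A
      ... | r , y≈r , r∈Anc =
        r , head-transfer-≈ e y≈r , r∈Anc , chain⇒walk r∈Anc (chain-transfer y≈r c)

      slide : ∀ {x y} → Headed y → x ── y → Reaches y → Reaches x
      slide hy e (inj₁ y≈b) = inj₁ (≈-cons hy e y≈b)
      slide hy e (inj₂ c)   = inj₂ (chain-transfer (inj₂ (──-sym e)) c)

      -- An arrow of `H` cannot lie inside a strongly connected component of `G`: the way back would
      -- be an anterior walk against its arrowhead.
      arrow-source : ∀ {x y} → x ⟶ y → Half (inj₁ a) (inj₁ b) (inj₁ x) tail (inj₁ y) → x ∈ E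
      arrow-source e h with h refl
      ... | inj₁ (inj₁ refl)    = inj₁ refl
      ... | inj₁ (inj₂ refl)    = inj₂ refl
      ... | inj₂ ((w , d) , _)  = ⊥-elim (anterior⇒no-head (ancestor⇒anterior w d) (left e))

      sel-source : ∀ {x s} → Half (inj₁ a) (inj₁ b) (inj₁ x) tail (inj₂ s) → x ∈ E
      sel-source h with h refl
      ... | inj₁ (inj₁ refl) = inj₁ refl
      ... | inj₁ (inj₂ refl) = inj₂ refl
      ... | inj₂ (p , _)     = ⊥-elim (sel-sink p)

      ends-not-undirected : ∀ {x y} → x ∈ E → y ∈ E → ¬ x ── y
      ends-not-undirected (inj₁ refl) (inj₁ refl) e = noSelfEdge (_ , _ , undir e)
      ends-not-undirected (inj₁ refl) (inj₂ refl) e = ¬adj (_ , _ , undir e)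
      ends-not-undirected (inj₂ refl) (inj₁ refl) e = ¬adj (_ , _ , undir (──-sym e))
      ends-not-undirected (inj₂ refl) (inj₂ refl) e = noSelfEdge (_ , _ , undir e)

      reaches : ∀ {x} → Star (Step Γ (Local (inj₁ a) (inj₁ b))) (inj₁ x) (inj₁ b) → Reaches x
      reaches ε = inj₁ (inj₁ refl)
      reaches ((_ , _ , right (arrow e) , (_ , y∈A) , h , _) ◅ s) with arrow-source e h
      ... | inj₂ refl = inj₁ (inj₁ refl)
      ... | inj₁ refl with attach (right e) y∈A (reaches s)
      ...   | _ , e′ , r∈Anc , w = ⊥-elim (no-inducingWalk
        ((_ , _ , e′ , (end∈Anc (inj₁ refl) , r∈Anc) , (λ _ → inj₁ refl) , (λ ())) ◅ w))
      reaches ((_ , _ , right (cycle e hx) , _) ◅ s) = slide (headed-transfer hx e) e (reaches s)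
      reaches ((_ , _ , left (arrow e) , _ , _ , h) ◅ s) with arrow-source e h
      ... | inj₁ refl = ⊥-elim (¬reaches-a (reaches s))
      -- The arrow comes from `b` itself, so the rest of the walk is dropped and a one-edge chain
      -- remains.
      ... | inj₂ refl = inj₂ (b , _ , left e , (λ _ → inj₂ refl) , end∈Anc (inj₂ refl) , ε)
      reaches ((_ , _ , left (cycle e hy) , _) ◅ s) = slide hy (──-sym e) (reaches s)
      reaches ((_ , _ , bidir (bidirected e) , (_ , y∈A) , _) ◅ s)
        with attach (bidir e) y∈A (reaches s)
      ... | r , e′ , r∈Anc , w = inj₂ (r , _ , e′ , (λ ()) , r∈Anc , w)
      -- A visit to a selected node either returns to the same node or crosses an undirected edge
      -- with both ends in `E`, which is impossible.
      reaches ((_ , _ , right sel₁ , _) ◅ (_ , _ , left sel₁ , _) ◅ s) = reaches s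
      reaches ((_ , _ , right sel₂ , _) ◅ (_ , _ , left sel₂ , _) ◅ s) = reaches s
      reaches ((_ , _ , right (sel₁ {p = e , _}) , _ , h , _) ◅ (_ , _ , left sel₂ , _ , _ , h′) ◅ s) =
        ⊥-elim (ends-not-undirected (sel-source h) (sel-source h′) e)
      reaches ((_ , _ , right (sel₂ {p = e , _}) , _ , h , _) ◅ (_ , _ , left sel₁ , _ , _ , h′) ◅ s) =
        ⊥-elim (ends-not-undirected (sel-source h′) (sel-source h) e)

    no-σ-inducingPath : ¬ σ-InducingPath G Sel (inj₁ a) (inj₁ b)
    no-σ-inducingPath (w , _ , ind) = ¬reaches-a (reaches (σ-inducing⇒local w ind))

  -- The canonical DMG is represented

  adjacent⇒σ-inducingPath : ∀ {a b} → a ≢ b → Adjacent H a b → σ-InducingPath G Sel (inj₁ a) (inj₁ b)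
  adjacent⇒σ-inducingPath {a} {b} a≢b (_ , _ , e) = path e
    where
    a≢b′ : inj₁ a ≢ inj₁ b
    a≢b′ refl = a≢b refl

    single : ∀ {m m′} → Edge Γ (inj₁ a) m m′ (inj₁ b) → σ-InducingPath G Sel (inj₁ a) (inj₁ b)
    single e = e ∷ [] , (a≢b′ ∷ []) ∷ [] ∷ [] , _

    path : ∀ {m m′} → Edge H a m m′ b → σ-InducingPath G Sel (inj₁ a) (inj₁ b)
    path (right e) = single (right (arrow e))
    path (left e)  = single (left (arrow e))
    path (bidir e) = single (bidir (bidirected e))
    path (undir e) with em {Headed a}
    ... | yes h = single (right (cycle e h))
    ... | no ¬h =
      -- The inner node is a collider that is itself selected.
      right (sel₁ {p = e , ¬h}) ∷ left sel₂ ∷ [] ,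
      ((λ ()) ∷ a≢b′ ∷ []) ∷ ((λ ()) ∷ []) ∷ [] ∷ [] ,
      ((λ _ → ∈⇒ancSet Γ (inj₂ (_ , refl))) , λ ¬c → ⊥-elim (¬c (refl , refl))) , _

  represents : Represents H G
  represents = record
    { simple       = simple
    ; adjacency    = λ {a} {b} a≢b → mk⇔ (adjacent⇒σ-inducingPath a≢b) λ p →
        case em {Adjacent H a b} of λ where
          (yes adj) → adj
          (no ¬adj) → ⊥-elim (no-σ-inducingPath a≢b ¬adj p)
    ; nonAncestral = λ where
        e (_ , inj₁ refl , w , d)       → anterior⇒no-head (ancestor⇒anterior w d) e
        e (_ , inj₂ (_ , refl) , w , d) → headed⇒not-selected (_ , _ , flip-edge H e) w d
    ; ancestral    = ancestor
    }
    where
    ancestor : ∀ {a b m} → Edge H a tail m b → inj₁ a ∈ AncSet Γ (｛ inj₁ b ｝ ∪ Sel)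
    ancestor (right e) = _ , inj₁ refl , anc-step Γ (arrow e) (anc-refl Γ)
    ancestor {a} (undir e) with em {Headed a}
    ... | yes h = _ , inj₁ refl , anc-step Γ (cycle e h) (anc-refl Γ)
    ... | no ¬h = _ , inj₂ (_ , refl) , anc-step Γ (sel₁ {p = e , ¬h}) (anc-refl Γ)

theorem1 : ∀ {ℓ} → ExcludedMiddle ℓ → (V : Set ℓ) (H : MixedGraph V) →
    (Σ[ S ∈ Set ℓ ] Σ[ G ∈ DMG (V ⊎ S) ] Represents H G) ⇔ IsσMAG H
theorem1 em V H = mk⇔
  (λ (_ , _ , represents) → Represented.isσMAG em represents)
  (λ mag → _ , _ , Canonical.represents em mag)
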